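{- For every $\varepsilon > 0$ there exists a constant $g' \in \{3, 5, 7, \dots\}$ (depending only on $\varepsilon$) such that graphs with odd girth at least $g'$ can be deterministically colored online using $O(n^{\varepsilon})$ colors. That is, there are $g'$ and a constant $C$ depending only on $\varepsilon$ such that, for every $n \ge 1$, some deterministic online coloring algorithm uses at most $C n^{\varepsilon}$ colors on every online input whose final graph has $n$ vertices and odd girth at least $g'$.
   Context: Graphs are finite, simple and undirected. Online coloring problem: a graph $G=(V,E)$ is initially empty; vertices are added one by one, each together with its edges to previously added vertices. Immediately after a vertex $v$ is added, the algorithm must irrevocably assign a color $c(v)\in\mathbb{N}$ different from the colors of all neighbors of $v$; only then is the next vertex presented. The number of colors used is $|\{c(v): v\in V\}|$. The number $n$ of vertices of the final graph is assumed to be known to the algorithm in advance. The odd girth of a graph is the length of its shortest odd-length cycle, or $+\infty$ if there is none (equivalently, the length of its shortest odd-length closed walk). -}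

module Defs where

open import Data.Empty using (⊥)
open import Data.Fin using (Fin; zero; suc)
open import Data.Fin.Subset using (Subset; _∈_)
open import Data.Integer using (+_)
open import Data.List using (List; []; _∷_; _∷ʳ_; length; deduplicate)
open import Data.List.Relation.Unary.Linked using (Linked)
open import Data.List.Relation.Unary.Unique.Propositional using (Unique)
open import Data.Nat using (ℕ; suc; _*_; _^_; _≤_; NonZero; parity)
open import Data.Nat.Properties using (_≟_)
open import Data.Parity.Base using (1ℙ)
open import Data.Product using (∃; _×_)
open import Data.Rational as ℚ using (ℚ; 0ℚ)
open import Data.Sum using (_⊎_)
open import Data.Vec using (Vec; []; _∷_; lookup; toList)
open import Function.Bundles using (_⇔_)
open import Relation.Binary.Construct.Add.Supremum.NonStrict _≤_ using (_≤⁺_) public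
open import Relation.Binary.PropositionalEquality using (_≡_; _≢_)
open import Relation.Nullary using (¬_)
open import Relation.Nullary.Construct.Add.Supremum using (_⁺; [_]; ⊤⁺) public

-- Dedekind reals: Lower q means q < x, and Upper q means x < q.
record ℝ : Set₁ where
  field
    Lower Upper     : ℚ → Set
    lower-inhabited : ∃ Lower
    upper-inhabited : ∃ Upper
    lower-rounded   : ∀ q → Lower q ⇔ (∃ λ r → q ℚ.< r × Lower r)
    upper-rounded   : ∀ r → Upper r ⇔ (∃ λ q → q ℚ.< r × Upper q)
    disjoint        : ∀ q → ¬ (Lower q × Upper q)
    located         : ∀ {q r} → q ℚ.< r → Lower q ⊎ Upper r

Positive : ℝ → Set
Positive x = ℝ.Lower x 0ℚ

-- The relation k ≤ C · n ^ x, for real x ≥ 0 and n ≥ 1. Since n ^ r is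
-- nondecreasing and continuous in r, n ^ x is the infimum of n ^ (p / q) over
-- the rationals p / q > x; and k ≤ C · n ^ (p / q) is k ^ q ≤ C ^ q * n ^ p.
infix 4 _≤_·_^ᴿ_

_≤_·_^ᴿ_ : ℕ → ℕ → ℕ → ℝ → Set
k ≤ C · n ^ᴿ x =
  ∀ p q .{{_ : NonZero q}} → ℝ.Upper x ((+ p) ℚ./ q) → k ^ q ≤ C ^ q * n ^ p

Odd : ℕ → Set
Odd k = parity k ≡ 1ℙ

-- A finite simple graph together with the order in which its vertices are
-- presented: G ▷ N adds to G a new vertex with set of neighbours N. As in
-- Vec, the newest vertex has index zero and the older ones are shifted by suc.
infixl 5 _▷_

data Graph : ℕ → Set where
  ∅   : Graph 0
  _▷_ : ∀ {n} → Graph n → Subset n → Graph (suc n)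

Adj : ∀ {n} → Graph n → Fin n → Fin n → Set
Adj (G ▷ N) zero    zero    = ⊥
Adj (G ▷ N) zero    (suc v) = v ∈ N
Adj (G ▷ N) (suc u) zero    = u ∈ N
Adj (G ▷ N) (suc u) (suc v) = Adj G u v

-- The cycle is given by its vertices, each listed once.
IsCycle : ∀ {n} → Graph n → List (Fin n) → Set
IsCycle G []       = ⊥
IsCycle G (v ∷ vs) =
  3 ≤ length (v ∷ vs) × Unique (v ∷ vs) × Linked (Adj G) ((v ∷ vs) ∷ʳ v)

OddCycle : ∀ {n} → Graph n → ℕ → Set
OddCycle G k = Odd k × (∃ λ vs → IsCycle G vs × length vs ≡ k)

IsOddGirth : ∀ {n} → Graph n → ℕ ⁺ → Set
IsOddGirth G [ k ] = OddCycle G k × (∀ l → OddCycle G l → k ≤ l)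
IsOddGirth G ⊤⁺    = ∀ l → ¬ OddCycle G l

ProperColouring : ∀ {n} → Graph n → Vec ℕ n → Set
ProperColouring G c = ∀ u v → Adj G u v → lookup c u ≢ lookup c v

-- A deterministic strategy colours the newest vertex from the graph presented
-- so far; the earlier colours need not be passed to it, as they are determined
-- by that graph.
Strategy : Set
Strategy = ∀ {n} → Graph (suc n) → ℕ

colouring : Strategy → ∀ {n} → Graph n → Vec ℕ n
colouring s ∅       = []
colouring s (G ▷ N) = s (G ▷ N) ∷ colouring s G

record OnlineAlgorithm : Set where
  field
    strategy : Strategy
    proper   : ∀ {n} (G : Graph n) → ProperColouring G (colouring strategy G)

coloursUsed : OnlineAlgorithm → ∀ {n} → Graph n → ℕ
coloursUsed A G =
  length (deduplicate _≟_ (toList (colouring (OnlineAlgorithm.strategy A) G)))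

{-# OPTIONS --safe #-}
module Submission where

-- Fix d with n < d ^ K and give every vertex a chain of clusters, one for each
-- level it reaches. A vertex arrives at level i with a seed: at least d ^ i
-- vertices, all at the end of walks of one common length. It joins a cluster
-- whose seed meets its own, or founds a new one; so distinct clusters have
-- disjoint seeds. Two clusters are linked once an edge joins vertices of them.
-- While a cluster has fewer than d links, its vertices are coloured at this level
-- by their number m of links and a slot: vertices of the same cluster with the
-- same m share their slot, and a new slot avoids those used for m by the linked
-- clusters, so slots below d suffice. A cluster with d links is full, and the
-- seeds of the linked clusters together are a seed of size d ^ (i + 1) for the
-- next level. Level K is never reached, for lack of vertices, and K d² colours
-- are used. The colouring is proper unless a cluster is linked to itself, and
-- that yields a short odd closed walk. For 1 / b ≤ ε take K = 2 b.

open import Defs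
open import Data.Empty using (⊥-elim)
open import Data.Fin as Fin using (Fin; zero; suc)
import Data.Fin.Properties as Fin
open import Data.Fin.Subset as Subset using (Subset)
import Data.Fin.Subset.Properties as Subset
open import Data.Integer as ℤ using (+_)
import Data.Integer.Properties as ℤ
open import Data.List using (List; []; _∷_; _++_; _∷ʳ_; map; concat; concatMap; filter;
  length; upTo; allFin; deduplicate)
open import Data.List.Properties using (≡-dec; length-map; length-++; length-upTo)
open import Data.List.Membership.Propositional using (_∈_; _∉_; find; lose)
open import Data.List.Membership.Propositional.Properties
  using (∈-map⁺; ∈-map⁻; ∈-filter⁺; ∈-filter⁻; ∈-concat⁻′;
         ∈-concatMap⁺; ∈-concatMap⁻; ∈-++⁺ˡ; ∈-++⁺ʳ; ∈-++⁻; ∈-upTo⁺;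
         ∈-upTo⁻; ∈-deduplicate⁺; ∈-deduplicate⁻; ∈-allFin; ∈-∃++)
open import Data.List.Relation.Binary.Disjoint.Propositional using (Disjoint)
open import Data.List.Relation.Binary.Subset.Propositional using (_⊆_)
open import Data.List.Relation.Unary.All as All using (All; []; _∷_)
import Data.List.Relation.Unary.All.Properties as All
open import Data.List.Relation.Unary.AllPairs using (AllPairs; []; _∷_)
open import Data.List.Relation.Unary.Any using (Any; here; there; any?)
open import Data.List.Relation.Unary.Linked using (Linked; []; [-]; _∷_)
open import Data.List.Relation.Unary.Unique.Propositional using (Unique)
open import Data.List.Relation.Unary.Unique.Propositional.Properties using (concat⁺; upTo⁺)
open import Data.List.Relation.Unary.Unique.DecPropositional.Properties using (deduplicate-!)
open import Data.Maybe using (Maybe; just; nothing; fromMaybe)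
open import Data.Nat
open import Data.Nat.ListAction using (sum)
open import Data.Nat.Induction using (<-wellFounded)
open import Data.Nat.Properties
open import Data.Nat.Solver using (module +-*-Solver)
import Data.Parity.Base as ℙ
import Data.Parity.Properties as ℙ
open import Data.Product using (∃; ∃₂; _×_; _,_; proj₁; proj₂)
import Data.Rational as ℚ
import Data.Rational.Properties as ℚ
import Data.Rational.Unnormalised as ℚᵘ
import Data.Rational.Unnormalised.Properties as ℚᵘ
open import Data.Sum using (_⊎_; inj₁; inj₂)
open import Data.Vec as Vec using (Vec; lookup)
open import Data.Vec.Membership.Propositional.Properties using (∈-toList⁻)
open import Data.Vec.Relation.Unary.Any using (index)
open import Data.Vec.Relation.Unary.Any.Properties using (lookup-index)
open import Function using (_∘_; Equivalence)
open import Induction.WellFounded using (Acc; acc)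
open import Relation.Binary.Construct.Add.Supremum.NonStrict _≤_ using ([≤]-injective)
open import Relation.Binary.Definitions using (tri<; tri≈; tri>)
open import Relation.Binary.PropositionalEquality hiding ([_])
open import Relation.Nullary using (¬_; Dec; yes; no; ¬?; _×-dec_; _⊎-dec_)

-- Counting in lists

module _ {A : Set} where

  unique-⊆⇒length-≤ : {xs ys : List A} → Unique xs → xs ⊆ ys → length xs ≤ length ys
  unique-⊆⇒length-≤ {[]} _ _ = z≤n
  unique-⊆⇒length-≤ {x ∷ xs} (x∉ ∷ u) xs⊆ with ∈-∃++ (xs⊆ (here refl))
  ... | as , bs , refl = begin
      suc (length xs)                  ≤⟨ s≤s (unique-⊆⇒length-≤ u shrunk) ⟩
      suc (length (as ++ bs))          ≡⟨ cong suc (length-++ as) ⟩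
      suc (length as + length bs)      ≡⟨ +-suc (length as) (length bs) ⟨
      length as + suc (length bs)      ≡⟨ length-++ as ⟨
      length (as ++ x ∷ bs)            ∎
    where
    open ≤-Reasoning
    shrunk : xs ⊆ as ++ bs
    shrunk y∈ with ∈-++⁻ as (xs⊆ (there y∈))
    ... | inj₁ p         = ∈-++⁺ˡ p
    ... | inj₂ (here refl) = ⊥-elim (All.lookup x∉ y∈ refl)
    ... | inj₂ (there p) = ∈-++⁺ʳ as p

-- Pigeonhole: `xs` cannot contain all of the `suc (length xs)` candidates. The bound on `s` later
-- keeps a slot at most the number of links.
fresh : ∀ xs → ∃ λ s → s ≤ length xs × s ∉ xs
fresh xs with any? (λ s → ¬? (any? (s ≟_) xs)) (upTo (suc (length xs)))
... | yes p with find p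
...   | s , s∈ , s∉ = s , s≤s⁻¹ (∈-upTo⁻ s∈) , s∉
fresh xs | no ¬p = ⊥-elim (1+n≰n (subst (_≤ length xs) (length-upTo (suc (length xs)))
  (unique-⊆⇒length-≤ (upTo⁺ (suc (length xs))) all-present)))
  where
  all-present : upTo (suc (length xs)) ⊆ xs
  all-present {s} s∈ with any? (s ≟_) xs
  ... | yes q = q
  ... | no ¬q = ⊥-elim (¬p (lose s∈ ¬q))

deduplicate-bounded : ∀ M (xs : List ℕ) → (∀ {x} → x ∈ xs → x < M) → length (deduplicate _≟_ xs) ≤ M
deduplicate-bounded M xs bound = subst (length (deduplicate _≟_ xs) ≤_) (length-upTo M)
  (unique-⊆⇒length-≤ (deduplicate-! _≟_ xs) λ x∈ → ∈-upTo⁺ (bound (∈-deduplicate⁻ _≟_ xs x∈)))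

concat-length : ∀ {A : Set} k (xss : List (List A)) → (∀ {xs} → xs ∈ xss → k ≤ length xs) →
  length xss * k ≤ length (concat xss)
concat-length k []         _ = z≤n
concat-length k (xs ∷ xss) h rewrite length-++ xs {concat xss} =
  +-mono-≤ (h (here refl)) (concat-length k xss (h ∘ there))

-- Walks

data Walk {A : Set} (R : A → A → Set) : ℕ → A → A → Set where
  []  : ∀ {x} → Walk R 0 x x
  _∷_ : ∀ {k x y z} → R x y → Walk R k y z → Walk R (suc k) x z

module _ {A : Set} {R : A → A → Set} where

  infixr 5 _◅◅_

  _◅◅_ : ∀ {k l x y z} → Walk R k x y → Walk R l y z → Walk R (k + l) x z
  []      ◅◅ q = q
  (e ∷ p) ◅◅ q = e ∷ (p ◅◅ q)

  module _ (R-sym : ∀ {x y} → R x y → R y x) where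

    reverse : ∀ {k x y} → Walk R k x y → Walk R k y x
    reverse []      = []
    reverse (e ∷ p) = snoc (reverse p) (R-sym e)
      where
      snoc : ∀ {k x y z} → Walk R k x y → R y z → Walk R (suc k) x z
      snoc []      e = e ∷ []
      snoc (f ∷ p) e = f ∷ snoc p e

  -- The start of every step, hence not the end of the walk.
  vertices : ∀ {k x y} → Walk R k x y → List A
  vertices []              = []
  vertices (_∷_ {x = x} e p) = x ∷ vertices p

  length-vertices : ∀ {k x y} (p : Walk R k x y) → length (vertices p) ≡ k
  length-vertices []      = refl
  length-vertices (_ ∷ p) = cong suc (length-vertices p)

  linked-vertices : ∀ {k x y} (p : Walk R k x y) → Linked R (vertices p ∷ʳ y)
  linked-vertices []          = [-]
  linked-vertices (e ∷ [])    = e ∷ [-]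
  linked-vertices (e ∷ f ∷ p) = e ∷ linked-vertices (f ∷ p)

  -- Since `vertices` omits the end, a step is left after `z`; so the closed piece cut off by a
  -- detour is strictly shorter than the whole.
  split-at : ∀ {k x y z} (p : Walk R k x y) → z ∈ vertices p →
    ∃₂ λ a b → Walk R a x z × Walk R (suc b) z y × a + suc b ≡ k
  split-at (_∷_ {k = k} e p) (here refl) = 0 , k , [] , e ∷ p , refl
  split-at (e ∷ p) (there z∈) with split-at p z∈
  ... | a , b , q , r , refl = suc a , b , e ∷ q , r , refl

  -- In a closed walk of odd length both the part at z and the rest are shorter
  -- closed walks, and one of them has odd length.
  Detour : ℕ → A → A → Set
  Detour k x y = ∃ λ z → ∃₂ λ a b → ∃ λ c →
    Walk R a x z × Walk R (suc b) z z × Walk R c z y × 0 < a + c × a + c + suc b ≡ k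

  unique-or-detour : (∀ x y → Dec (x ≡ y)) → ∀ {k x y} (p : Walk R k x y) →
    Unique (vertices p) ⊎ Detour k x y
  unique-or-detour _≟ᵥ_ [] = inj₁ []
  unique-or-detour _≟ᵥ_ (_∷_ {x = x} e p) with unique-or-detour _≟ᵥ_ p
  ... | inj₂ (z , a , b , c , q , r , s , _ , refl) =
    inj₂ (z , suc a , b , c , e ∷ q , r , s , z<s , refl)
  ... | inj₁ u with any? (x ≟ᵥ_) (vertices p)
  ...   | no x∉ = inj₁ (All.¬Any⇒All¬ _ x∉ ∷ u)
  ...   | yes x∈ with split-at p x∈
  ...     | a , b , q , r , refl =
    inj₂ (x , 0 , a , suc b , [] , e ∷ q , r , z<s , +-comm (suc b) (suc a))

-- Odd closed walks contain odd cycles.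

odd-summand : ∀ m n → Odd (m + n) → Odd m ⊎ Odd n
odd-summand m n odd rewrite ℙ.+-homo-+ m n with parity m | parity n
... | ℙ.1ℙ | _    = inj₁ refl
... | ℙ.0ℙ | ℙ.1ℙ = inj₂ refl

adj-sym : ∀ {n} (G : Graph n) {u v} → Adj G u v → Adj G v u
adj-sym (G ▷ N) {zero}  {suc v} a = a
adj-sym (G ▷ N) {suc u} {zero}  a = a
adj-sym (G ▷ N) {suc u} {suc v} a = adj-sym G a

adj-irrefl : ∀ {n} (G : Graph n) {u} → ¬ Adj G u u
adj-irrefl (G ▷ N) {suc u} a = adj-irrefl G a

odd-closed-walk⇒odd-cycle : ∀ {n} (G : Graph n) {k v} → Odd k → Walk (Adj G) k v v →
  ∃ λ l → OddCycle G l × l ≤ k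
odd-closed-walk⇒odd-cycle G {k} = go k (<-wellFounded k)
  where
  cycle : ∀ {k v} → Odd k → (p : Walk (Adj G) k v v) → Unique (vertices p) → IsCycle G (vertices p)
  -- Parity excludes the lengths 0 and 2, and a closed walk of length 1 would be a loop.
  cycle odd (e ∷ [])          u = ⊥-elim (adj-irrefl G e)
  cycle odd p@(_ ∷ _ ∷ _ ∷ _) u = s≤s (s≤s (s≤s z≤n)) , u , linked-vertices p

  go : ∀ k {v} → Acc _<_ k → Odd k → Walk (Adj G) k v v → ∃ λ l → OddCycle G l × l ≤ k
  go k (acc rs) odd p with unique-or-detour Fin._≟_ p
  ... | inj₁ u = k , (odd , vertices p , cycle odd p u , length-vertices p) , ≤-refl
  ... | inj₂ (z , a , b , c , q , r , s , 0<a+c , refl) with odd-summand (a + c) (suc b) odd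
  ...   | inj₁ o with go (a + c) (rs (m<m+n (a + c) z<s)) o (q ◅◅ s)
  ...     | l , cyc , l≤ = l , cyc , ≤-trans l≤ (m≤m+n (a + c) (suc b))
  go k (acc rs) odd p | inj₂ (z , a , b , c , q , r , s , 0<a+c , refl) | inj₂ o
    with go (suc b) (rs (m<n+m (suc b) 0<a+c)) o r
  ... | l , cyc , l≤ = l , cyc , ≤-trans l≤ (m≤n+m (suc b) (a + c))

-- The algorithm on one level

Cluster : Set
Cluster = List ℕ

infix 4 _≟ᶜ_
_≟ᶜ_ : (C D : Cluster) → Dec (C ≡ D)
_≟ᶜ_ = ≡-dec _≟_

-- The trace left at one level by a vertex that reached it. Vertices are named
-- by their position in the order of presentation, and clusters by the seed of
-- their first member.
record Entry : Set where
  constructor entry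
  field
    vertex  : ℕ
    cluster : Cluster
    links   : List Cluster
    slot    : ℕ
open Entry

-- Entries with the same key receive the same slot.
HasKey : Cluster → ℕ → Entry → Set
HasKey C m e = cluster e ≡ C × length (links e) ≡ m

hasKey? : ∀ C m e → Dec (HasKey C m e)
hasKey? C m e = (cluster e ≟ᶜ C) ×-dec (length (links e) ≟ m)

module Level (es : List Entry) (nbs : List ℕ) where

  Meets : Cluster → Cluster → Set
  Meets C D = Any (_∈ D) C

  meets? : ∀ C D → Dec (Meets C D)
  meets? C D = any? (λ x → any? (x ≟_) D) C

  clusterIn : List Entry → Cluster → Cluster
  clusterIn []       T = T
  clusterIn (e ∷ fs) T with meets? T (cluster e)
  ... | yes _ = cluster e
  ... | no  _ = clusterIn fs T

  clusterOf : Cluster → Cluster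
  clusterOf = clusterIn es

  data Joined (fs : List Entry) (T : Cluster) : Cluster → Set where
    old : ∀ {e} → e ∈ fs → Meets T (cluster e) → Joined fs T (cluster e)
    new : (∀ {e} → e ∈ fs → Disjoint T (cluster e)) → Joined fs T T

  joined : ∀ fs T → Joined fs T (clusterIn fs T)
  joined []       T = new λ ()
  joined (e ∷ fs) T with meets? T (cluster e)
  ... | yes m = old (here refl) m
  ... | no ¬m with clusterIn fs T | joined fs T
  ...   | _ | old e∈ m = old (there e∈) m
  ...   | _ | new d = new λ { (here refl) (x∈ , y∈) → ¬m (lose x∈ y∈) ; (there e∈) → d e∈ }

  -- `nbs` belongs to the arriving vertex, so the second alternative is meant only for the cluster
  -- `C` that this vertex joins.
  Touches : Cluster → Entry → Set
  Touches C e = C ∈ links e ⊎ vertex e ∈ nbs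

  touches? : ∀ C e → Dec (Touches C e)
  touches? C e = any? (C ≟ᶜ_) (links e) ⊎-dec any? (vertex e ≟_) nbs

  -- Links are symmetric: a link that an entry of C does not record is recorded
  -- by the other cluster.
  inherited received candidates linksOf : Cluster → List Cluster
  inherited C  = concatMap links (filter (λ e → cluster e ≟ᶜ C) es)
  received C   = map cluster (filter (touches? C) es)
  candidates C = inherited C ++ received C
  linksOf C    = deduplicate _≟ᶜ_ (candidates C)

  links-inherited : ∀ {e D} → e ∈ es → D ∈ links e → D ∈ linksOf (cluster e)
  links-inherited e∈ D∈ = ∈-deduplicate⁺ _≟ᶜ_
    (∈-++⁺ˡ (∈-concatMap⁺ links (lose (∈-filter⁺ (λ e → cluster e ≟ᶜ _) e∈ refl) D∈)))

  links-received : ∀ {e C} → e ∈ es → Touches C e → cluster e ∈ linksOf C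
  links-received {C = C} e∈ t = ∈-deduplicate⁺ _≟ᶜ_
    (∈-++⁺ʳ (inherited C) (∈-map⁺ cluster (∈-filter⁺ (touches? C) e∈ t)))

  data Origin (C D : Cluster) : Set where
    inherit : ∀ {e} → e ∈ es → cluster e ≡ C → D ∈ links e → Origin C D
    receive : ∀ {e} → e ∈ es → cluster e ≡ D → Touches C e → Origin C D

  origin : ∀ {C D} → D ∈ linksOf C → Origin C D
  origin {C} D∈ with ∈-++⁻ (inherited C) (∈-deduplicate⁻ _≟ᶜ_ (candidates C) D∈)
  ... | inj₁ p with find (∈-concatMap⁻ links p)
  ...   | e , e∈ , q with ∈-filter⁻ (λ e → cluster e ≟ᶜ C) e∈
  ...     | e∈es , eq = inherit e∈es eq q
  origin {C} D∈ | inj₂ p with ∈-map⁻ cluster p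
  ... | e , e∈ , refl with ∈-filter⁻ (touches? C) e∈
  ...   | e∈es , t = receive e∈es refl t

  slotAt : Cluster → ℕ → Maybe ℕ
  slotAt C m with any? (hasKey? C m) es
  ... | yes p = just (slot (proj₁ (find p)))
  ... | no  _ = nothing

  -- The default 0, for a cluster without an entry of `m` links, at most forbids 0 needlessly. Each
  -- linked cluster still forbids one slot, so the bound on the fresh slot stands.
  takenSlot : ℕ → Cluster → ℕ
  takenSlot m D = fromMaybe 0 (slotAt D m)

  slotOf : Cluster → List Cluster → ℕ
  slotOf C L with slotAt C (length L)
  ... | just s  = s
  ... | nothing = proj₁ (fresh (map (takenSlot (length L)) L))

  data Slotted (C : Cluster) (L : List Cluster) : ℕ → Set where
    copied : ∀ {e} → e ∈ es → HasKey C (length L) e → Slotted C L (slot e)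
    chosen : ∀ {s} → (∀ {e} → e ∈ es → ¬ HasKey C (length L) e) → s ≤ length L →
      s ∉ map (takenSlot (length L)) L → Slotted C L s

  slotted : ∀ C L → Slotted C L (slotOf C L)
  slotted C L with any? (hasKey? C (length L)) es
  ... | yes p with find p
  ...   | e , e∈ , key = copied e∈ key
  slotted C L | no ¬p with fresh (map (takenSlot (length L)) L)
  ... | s , s≤ , s∉ = chosen (λ e∈ key → ¬p (lose e∈ key)) (subst (s ≤_) (length-map _ L) s≤) s∉

  SlotsAgree : Set
  SlotsAgree = ∀ {e f C m} → e ∈ es → f ∈ es → HasKey C m e → HasKey C m f → slot e ≡ slot f

  takenSlot-correct : SlotsAgree → ∀ {e C m} → e ∈ es → HasKey C m e → takenSlot m C ≡ slot e
  takenSlot-correct agree {e} {C} {m} e∈ key with any? (hasKey? C m) es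
  ... | no ¬p = ⊥-elim (¬p (lose e∈ key))
  ... | yes p with find p
  ...   | f , f∈ , key′ = agree f∈ e∈ key′ key

  newEntry : ℕ → Cluster → Entry
  newEntry v T = entry v C (linksOf C) (slotOf C (linksOf C))
    where
    C = clusterOf T

-- Lengths of the walks.

mutual
  -- To rise a level, go from a member into its own cluster and then along a link.
  seedRadius : ℕ → ℕ
  seedRadius zero    = 0
  seedRadius (suc i) = radius i + linkLength i

  -- From a member through a vertex common to its seed and the cluster to the
  -- founder, and from there to any vertex of the cluster.
  radius : ℕ → ℕ
  radius i = seedRadius i + (seedRadius i + seedRadius i)

  -- From a vertex of one cluster back to a member, across an edge to a member of the other, and on
  -- to any vertex there. The form `r + suc r` is odd at every level.
  linkLength : ℕ → ℕ
  linkLength i = radius i + suc (radius i)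

-- The invariant of one level

module Invariant (E : ℕ → ℕ → Set) (E-sym : ∀ {x y} → E x y → E y x) (n d : ℕ) .{{_ : NonZero d}} where

  W : ℕ → ℕ → ℕ → Set
  W = Walk E

  back : ∀ {k x y} → W k x y → W k y x
  back = reverse (λ {x} {y} → E-sym {x} {y})

  -- The walks have one exact length, not a bound, so that the parity of closed walks made from them
  -- is known.
  record Seed (i v : ℕ) (T : Cluster) : Set where
    field
      unique  : Unique T
      large   : d ^ i ≤ length T
      bounded : ∀ {w} → w ∈ T → w < n
      within  : ∀ {w} → w ∈ T → W (seedRadius i) v w

  Connected : ℕ → Cluster → Cluster → Set
  Connected i C D = ∀ {x y} → x ∈ C → y ∈ D → W (linkLength i) x y

  -- Promotion rests on the fields about seeds and links, properness on `slot≤` and `separate`;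
  -- `agree` makes the slot of a cluster for a given number of links well defined.
  record Inv (i : ℕ) (es : List Entry) : Set where
    field
      seeded   : ∀ {e} → e ∈ es → ∃ λ z → Seed i z (cluster e)
      reach    : ∀ {e w} → e ∈ es → w ∈ cluster e → W (radius i) (vertex e) w
      linked   : ∀ {e D} → e ∈ es → D ∈ links e → Connected i (cluster e) D
      links-∈  : ∀ {e D} → e ∈ es → D ∈ links e → ∃ λ f → f ∈ es × cluster f ≡ D
      links-!  : ∀ {e} → e ∈ es → Unique (links e)
      disjoint : ∀ {e f} → e ∈ es → f ∈ es → cluster e ≡ cluster f ⊎ Disjoint (cluster e) (cluster f)
      slot≤    : ∀ {e} → e ∈ es → slot e ≤ length (links e)
      agree    : ∀ {e f C m} → e ∈ es → f ∈ es → HasKey C m e → HasKey C m f → slot e ≡ slot f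
      separate : ∀ {e f} → e ∈ es → f ∈ es → cluster e ∈ links f →
        length (links e) ≡ length (links f) → slot e ≢ slot f

  inv-[] : ∀ {i} → Inv i []
  inv-[] = record { seeded = λ () ; reach = λ () ; linked = λ () ; links-∈ = λ () ; links-! = λ ()
                  ; disjoint = λ () ; slot≤ = λ () ; agree = λ () ; separate = λ () }

  seed-nonempty : ∀ {i v T} → Seed i v T → ∃ (_∈ T)
  seed-nonempty {i} {T = []}    s = ⊥-elim (1+n≰n (≤-trans (m^n>0 d i) (Seed.large s)))
  seed-nonempty     {T = x ∷ T} s = x , here refl

  base : ∀ {v} → v < n → Seed 0 v (v ∷ [])
  base v<n = record { unique = [] ∷ [] ; large = ≤-refl
    ; bounded = λ { (here refl) → v<n } ; within = λ { (here refl) → [] } }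

  module Step {i es nbs v T} (inv : Inv i es) (seed : Seed i v T)
    (nbs-adj : ∀ {u} → u ∈ nbs → E v u)
    (no-closed : ∀ {x} → ¬ W (linkLength i) x x) where

    open Inv inv
    open Level es nbs

    C : Cluster
    C = clusterOf T

    e₀ : Entry
    e₀ = newEntry v T

    C-seeded : ∃ λ z → Seed i z C
    C-seeded with clusterOf T | joined es T
    ... | _ | old e∈ _ = seeded e∈
    ... | _ | new _    = v , seed

    C-reach : ∀ {w} → w ∈ C → W (radius i) v w
    C-reach w∈ with clusterOf T | joined es T
    -- A founder reaches its seed directly; going there, back and there again gives the same length
    -- as for later members.
    ... | _ | new _ = Seed.within seed w∈ ◅◅ back (Seed.within seed w∈) ◅◅ Seed.within seed w∈
    ... | _ | old e∈ m with find m | seeded e∈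
    ...   | x , x∈T , x∈C | z , s = Seed.within seed x∈T ◅◅ back (Seed.within s x∈C) ◅◅ Seed.within s w∈

    C-disjoint : ∀ {e} → e ∈ es → C ≡ cluster e ⊎ Disjoint C (cluster e)
    C-disjoint e∈ with clusterOf T | joined es T
    ... | _ | old f∈ _ = disjoint f∈ e∈
    ... | _ | new d    = inj₂ (d e∈)

    C-linked : ∀ {D} → D ∈ linksOf C → Connected i C D
    C-linked D∈ x∈ y∈ with origin D∈
    ... | inherit e∈ eq D∈e = linked e∈ D∈e (subst (_ ∈_) (sym eq) x∈) y∈
    ... | receive e∈ refl (inj₁ C∈) = back (linked e∈ C∈ y∈ x∈)
    ... | receive e∈ refl (inj₂ u∈) = back (C-reach x∈) ◅◅ (nbs-adj u∈ ∷ reach e∈ y∈)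

    C-links-∈ : ∀ {D} → D ∈ linksOf C → ∃ λ f → f ∈ es × cluster f ≡ D
    C-links-∈ D∈ with origin D∈
    ... | inherit e∈ _ D∈e = links-∈ e∈ D∈e
    ... | receive e∈ eq _  = _ , e∈ , eq

    -- A self-link would give a closed walk of the odd length `linkLength i`; this is where the odd
    -- girth enters.
    C∉links : C ∉ linksOf C
    C∉links C∈ with C-seeded
    ... | z , s with seed-nonempty s
    ...   | x , x∈ = no-closed (C-linked C∈ x∈ x∈)

    -- Links only accumulate: those recorded by `e` are all in `linksOf C`. As `links e` has no
    -- repetitions, equal length leaves no room for a further one.
    same-key⇒links-⊇ : ∀ {e} → e ∈ es → HasKey C (length (linksOf C)) e → linksOf C ⊆ links e
    same-key⇒links-⊇ {e} e∈ (refl , len) {D} D∈ with any? (D ≟ᶜ_) (links e)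
    ... | yes p = p
    ... | no ¬p = ⊥-elim (1+n≰n (subst (suc (length (links e)) ≤_) (sym len)
      (unique-⊆⇒length-≤ (All.¬Any⇒All¬ _ ¬p ∷ links-! e∈)
        λ { (here refl) → D∈ ; (there q) → links-inherited e∈ q })))

    -- A chosen slot avoids that of `e` by construction. A copied one comes from an earlier entry
    -- whose links already contained `cluster e`, so the two were separated before.
    C-separate : ∀ {e} → e ∈ es → cluster e ∈ linksOf C →
      length (links e) ≡ length (linksOf C) → slot e ≢ slot e₀
    C-separate e∈ D∈ len eq with slotOf C (linksOf C) | slotted C (linksOf C)
    ... | _ | copied f∈ key = separate e∈ f∈ (same-key⇒links-⊇ f∈ key D∈)
      (trans len (sym (proj₂ key))) eq
    ... | _ | chosen _ _ s∉ = s∉ (subst (_∈ map (takenSlot _) (linksOf C))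
      (trans (takenSlot-correct agree e∈ (refl , len)) eq) (∈-map⁺ (takenSlot _) D∈))

    C-agree : ∀ {e D m} → e ∈ es → HasKey D m e → HasKey D m e₀ → slot e ≡ slot e₀
    C-agree e∈ key (refl , refl) with slotOf C (linksOf C) | slotted C (linksOf C)
    ... | _ | copied f∈ key′ = agree e∈ f∈ key key′
    ... | _ | chosen ¬key _ _ = ⊥-elim (¬key e∈ key)

    C-slot≤ : slot e₀ ≤ length (linksOf C)
    C-slot≤ with slotOf C (linksOf C) | slotted C (linksOf C)
    ... | _ | copied f∈ key  = subst (_ ≤_) (proj₂ key) (slot≤ f∈)
    ... | _ | chosen _ s≤ _ = s≤

    inv′ : Inv i (e₀ ∷ es)
    inv′ = record
      { seeded   = λ { (here refl) → C-seeded ; (there e∈) → seeded e∈ }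
      ; reach    = λ { (here refl) → C-reach ; (there e∈) → reach e∈ }
      ; linked   = λ { (here refl) D∈ → C-linked D∈ ; (there e∈) D∈ → linked e∈ D∈ }
      ; links-∈  = λ { (here refl) D∈ → weaken (C-links-∈ D∈)
                     ; (there e∈) D∈ → weaken (links-∈ e∈ D∈) }
      ; links-!  = λ { (here refl) → deduplicate-! _≟ᶜ_ (candidates C) ; (there e∈) → links-! e∈ }
      ; disjoint = λ { (here refl) (here refl) → inj₁ refl
                     ; (here refl) (there f∈) → C-disjoint f∈
                     ; (there e∈) (here refl) → flip-disjoint (C-disjoint e∈)
                     ; (there e∈) (there f∈) → disjoint e∈ f∈ }
      ; slot≤    = λ { (here refl) → C-slot≤ ; (there e∈) → slot≤ e∈ }
      ; agree    = λ { (here refl) (here refl) _ _ → refl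
                     ; (here refl) (there f∈) k k′ → sym (C-agree f∈ k′ k)
                     ; (there e∈) (here refl) k k′ → C-agree e∈ k k′
                     ; (there e∈) (there f∈) → agree e∈ f∈ }
      ; separate = λ { (here refl) (here refl) C∈ _ → ⊥-elim (C∉links C∈)
                     -- Here the older entry records the link to `C`; symmetry of links moves it to
                     -- `linksOf C`.
                     ; (here refl) (there f∈) C∈ len →
                         C-separate f∈ (links-received f∈ (inj₁ C∈)) (sym len) ∘ sym
                     ; (there e∈) (here refl) → C-separate e∈
                     ; (there e∈) (there f∈) → separate e∈ f∈ }
      }
      where
      weaken : ∀ {D} → (∃ λ f → f ∈ es × cluster f ≡ D) → ∃ λ f → f ∈ e₀ ∷ es × cluster f ≡ D
      weaken (f , f∈ , eq) = f , there f∈ , eq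
      flip-disjoint : ∀ {C D : Cluster} → C ≡ D ⊎ Disjoint C D → D ≡ C ⊎ Disjoint D C
      flip-disjoint (inj₁ eq) = inj₁ (sym eq)
      flip-disjoint (inj₂ dj) = inj₂ λ (x , y) → dj (y , x)

  pairwise-disjoint : ∀ {i es} → Inv i es → ∀ L → Unique L →
    (∀ {D} → D ∈ L → ∃ λ f → f ∈ es × cluster f ≡ D) → AllPairs Disjoint L
  pairwise-disjoint inv []      []       _  = []
  pairwise-disjoint inv (C ∷ L) (C∉ ∷ u) L⊆ =
    All.tabulate disj ∷ pairwise-disjoint inv L u (L⊆ ∘ there)
    where
    disj : ∀ {D} → D ∈ L → Disjoint C D
    disj D∈ with L⊆ (here refl) | L⊆ (there D∈)
    ... | e , e∈ , refl | f , f∈ , refl with Inv.disjoint inv e∈ f∈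
    ...   | inj₁ eq = ⊥-elim (All.lookup C∉ D∈ eq)
    ...   | inj₂ dj = dj

  promote : ∀ {i es e} → Inv i es → e ∈ es → d ≤ length (links e) →
    Seed (suc i) (vertex e) (concat (links e))
  promote {i} {es} {e} inv e∈ d≤ = record
    { unique  = concat⁺ (All.tabulate (λ D∈ → Seed.unique (proj₂ (link-seed D∈))))
                  (pairwise-disjoint inv (links e) (links-! e∈) (links-∈ e∈))
    ; large   = ≤-trans (*-monoˡ-≤ (d ^ i) d≤)
                  (concat-length (d ^ i) (links e) λ D∈ → Seed.large (proj₂ (link-seed D∈)))
    ; bounded = bounded
    ; within  = within
    }
    where
    open Inv inv
    link-seed : ∀ {D} → D ∈ links e → ∃ λ z → Seed i z D
    link-seed D∈ with links-∈ e∈ D∈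
    ... | f , f∈ , refl = seeded f∈
    bounded : ∀ {w} → w ∈ concat (links e) → w < n
    bounded w∈ with ∈-concat⁻′ (links e) w∈
    ... | D , w∈D , D∈ = Seed.bounded (proj₂ (link-seed D∈)) w∈D
    within : ∀ {w} → w ∈ concat (links e) → W (seedRadius (suc i)) (vertex e) w
    within w∈ with ∈-concat⁻′ (links e) w∈ | seed-nonempty (proj₂ (seeded e∈))
    -- Any vertex `x` of the own cluster serves as a stopover, since `linked` covers all pairs.
    ... | D , w∈D , D∈ | x , x∈ = reach e∈ x∈ ◅◅ linked e∈ D∈ x∈ w∈D
-- The algorithm on all levels

-- Indices shift when a vertex is added; counting from the oldest gives fixed names, so stored
-- entries stay valid.
rank : ∀ {n} → Fin n → ℕ
rank {suc n} zero    = n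
rank {suc n} (suc u) = rank u

rank< : ∀ {n} (u : Fin n) → rank u < n
rank< {suc n} zero    = n<1+n n
rank< {suc n} (suc u) = m<n⇒m<1+n (rank< u)

rank-injective : ∀ {n} (u v : Fin n) → rank u ≡ rank v → u ≡ v
rank-injective zero    zero    _  = refl
rank-injective zero    (suc v) eq = ⊥-elim (<-irrefl (sym eq) (rank< v))
rank-injective (suc u) zero    eq = ⊥-elim (<-irrefl eq (rank< u))
rank-injective (suc u) (suc v) eq = cong suc (rank-injective u v eq)

members : ∀ {n} → Subset n → List (Fin n)
members N = filter (Subset._∈? N) (allFin _)

∈-members : ∀ {n} {N : Subset n} {u} → u Subset.∈ N → u ∈ members N
∈-members {N = N} u∈ = ∈-filter⁺ (Subset._∈? N) (∈-allFin _) u∈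

∈-members⁻ : ∀ {n} {N : Subset n} {u} → u ∈ members N → u Subset.∈ N
∈-members⁻ {N = N} u∈ = proj₂ (∈-filter⁻ (Subset._∈? N) {xs = allFin _} u∈)

ranks : ∀ {n} → Subset n → List ℕ
ranks N = map rank (members N)

digits-injective : ∀ d a b {r s} → r < d → s < d → a * d + r ≡ b * d + s → a ≡ b × r ≡ s
digits-injective d zero    zero    r< s< eq = refl , eq
digits-injective d zero    (suc b) {s = s} r< s< eq =
  ⊥-elim (<⇒≱ r< (subst (d ≤_) (sym (trans eq (+-assoc d (b * d) s))) (m≤m+n d (b * d + s))))
digits-injective d (suc a) zero    {r} r< s< eq =
  ⊥-elim (<⇒≱ s< (subst (d ≤_) (trans (sym (+-assoc d (a * d) r)) eq) (m≤m+n d (a * d + r))))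
digits-injective d (suc a) (suc b) {r} {s} r< s< eq
  with digits-injective d a b r< s< (+-cancelˡ-≡ d _ _
         (trans (sym (+-assoc d (a * d) r)) (trans eq (+-assoc d (b * d) s))))
... | refl , eq′ = refl , eq′

digits-< : ∀ {d a A r} → a < A → r < d → a * d + r < A * d
digits-< {d} {a} {A} {r} a< r< = begin-strict
  a * d + r  <⟨ +-monoʳ-< (a * d) r< ⟩
  a * d + d  ≡⟨ +-comm (a * d) d ⟩
  suc a * d  ≤⟨ *-monoˡ-≤ d a< ⟩
  A * d      ∎
  where open ≤-Reasoning

∈⇒≤sum : ∀ {x xs} → x ∈ xs → x ≤ sum xs
∈⇒≤sum {xs = x ∷ xs} (here refl) = m≤m+n x (sum xs)
∈⇒≤sum {xs = y ∷ xs} (there x∈)  = ≤-trans (∈⇒≤sum x∈) (m≤n+m (sum xs) y)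

-- The fallback is needed only for graphs violating the promise.
pick : Maybe ℕ → List ℕ → ℕ
pick nothing  xs = suc (sum xs)
pick (just c) xs with any? (c ≟_) xs
... | yes _ = suc (sum xs)
... | no  _ = c

pick-∉ : ∀ c xs → pick c xs ∉ xs
pick-∉ nothing  xs p = 1+n≰n (∈⇒≤sum p)
pick-∉ (just c) xs p with any? (c ≟_) xs
... | yes _ = 1+n≰n (∈⇒≤sum p)
... | no ¬p = ¬p p

pick-just : ∀ {c xs} → c ∉ xs → pick (just c) xs ≡ c
pick-just {c} {xs} c∉ with any? (c ≟_) xs
... | yes p = ⊥-elim (c∉ p)
... | no  _ = refl

module Algorithm (d K : ℕ) where

  History : Set
  History = ℕ → List Entry

  entryAt : History → List ℕ → ℕ → ℕ → Cluster → Entry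
  entryAt S nbs v i T = Level.newEntry (S i) nbs v T

  promoted : Entry → Maybe Cluster
  promoted e with d ≤? length (links e)
  ... | yes _ = just (concat (links e))
  ... | no  _ = nothing

  -- nothing means that the vertex stopped at a lower level.
  seedAt : History → List ℕ → ℕ → ℕ → Maybe Cluster
  seedAt S nbs v zero    = just (v ∷ [])
  seedAt S nbs v (suc i) with seedAt S nbs v i
  ... | just T  = promoted (entryAt S nbs v i T)
  ... | nothing = nothing

  -- A numeral in base `d` with digits level, number of links and slot: injective when the last two
  -- are below `d`, and below `K * d * d` when moreover the level is below `K`.
  code : ℕ → Entry → ℕ
  code i e = (i * d + length (links e)) * d + slot e

  -- Scanning downwards finds the highest level reached; at the lower ones the vertex was promoted,
  -- so its cluster was full.
  codeBelow : History → List ℕ → ℕ → ℕ → Maybe ℕ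
  codeBelow S nbs v zero    = nothing
  codeBelow S nbs v (suc k) with seedAt S nbs v k
  ... | just T  = just (code k (entryAt S nbs v k T))
  ... | nothing = codeBelow S nbs v k

  extend : History → List ℕ → ℕ → History
  extend S nbs v i with seedAt S nbs v i
  ... | just T  = entryAt S nbs v i T ∷ S i
  ... | nothing = S i

  history : ∀ {n} → Graph n → History
  history ∅             i = []
  history (_▷_ {n} G N) i = extend (history G) (ranks N) n i

  coloursOf : ∀ {n} → Vec ℕ n → Subset n → List ℕ
  coloursOf c N = map (lookup c) (members N)

  colours : ∀ {n} → Graph n → Vec ℕ n
  colours ∅             = Vec.[]
  colours (_▷_ {n} G N) =
    pick (codeBelow (history G) (ranks N) n K) (coloursOf (colours G) N) Vec.∷ colours G

  strategy : Strategy
  strategy G = Vec.head (colours G)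

  colouring≡colours : ∀ {n} (G : Graph n) → colouring strategy G ≡ colours G
  colouring≡colours ∅       = refl
  colouring≡colours (G ▷ N) = cong (strategy (G ▷ N) Vec.∷_) (colouring≡colours G)

  colours-proper : ∀ {n} (G : Graph n) → ProperColouring G (colours G)
  colours-proper (G ▷ N) zero    (suc v) v∈ eq = pick-∉ (codeBelow (history G) (ranks N) _ K) _
    (subst (_∈ coloursOf (colours G) N) (sym eq) (∈-map⁺ (lookup (colours G)) (∈-members v∈)))
  colours-proper (G ▷ N) (suc u) zero    u∈ eq = colours-proper (G ▷ N) zero (suc u) u∈ (sym eq)
  colours-proper (G ▷ N) (suc u) (suc v) a  eq = colours-proper G u v a eq

  algorithm : OnlineAlgorithm
  algorithm = record
    { strategy = strategy
    ; proper   = λ G → subst (ProperColouring G) (sym (colouring≡colours G)) (colours-proper G)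
    }

-- Properness of the codes and the bound on the colours, given the promise.

module Correctness (E : ℕ → ℕ → Set) (E-sym : ∀ {x y} → E x y → E y x) (n d K : ℕ) .{{_ : NonZero d}}
  (n<d^K : n < d ^ K) (no-closed : ∀ {i x} → i < K → ¬ Walk E (linkLength i) x x) where

  open Algorithm d K
  open Invariant E E-sym n d

  -- `E` stays fixed while the graph grows, so walks built at an earlier stage need no transport.
  Embeds : ∀ {m} → Graph m → Set
  Embeds G = ∀ u v → Adj G u v → E (rank u) (rank v)

  older : ∀ {m} {G : Graph m} {N} → Embeds (G ▷ N) → Embeds G
  older emb u v = emb (suc u) (suc v)

  AllInv : History → Set
  AllInv S = ∀ {i} → i < K → Inv i (S i)

  code-injective : ∀ i j e f → length (links e) < d → length (links f) < d →
    slot e < d → slot f < d → code i e ≡ code j f →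
    i ≡ j × length (links e) ≡ length (links f) × slot e ≡ slot f
  code-injective i j e f le lf se sf eq
    with digits-injective d (i * d + length (links e)) (j * d + length (links f)) se sf eq
  ... | eq′ , slots with digits-injective d i j le lf eq′
  ...   | levels , lengths = levels , lengths , slots

  -- Evidence that the colour is a genuine code and not the fallback.
  record Coded (S : History) (v c : ℕ) : Set where
    field
      {level}  : ℕ
      {trace}  : Entry
      level<K  : level < K
      present  : trace ∈ S level
      owner    : vertex trace ≡ v
      few      : length (links trace) < d
      is-code  : c ≡ code level trace

  there-extend : ∀ {S nbs v i e} → e ∈ S i → e ∈ extend S nbs v i
  there-extend {S} {nbs} {v} {i} e∈ with seedAt S nbs v i
  ... | just _  = there e∈
  ... | nothing = e∈

  here-extend : ∀ {S nbs v i T} → seedAt S nbs v i ≡ just T → entryAt S nbs v i T ∈ extend S nbs v i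
  here-extend {S} {nbs} {v} {i} eq with seedAt S nbs v i
  here-extend refl | just _ = here refl

  module Newest {S nbs v} (invs : AllInv S) (v<n : v < n) (nbs-adj : ∀ {u} → u ∈ nbs → E v u) where

    step-inv : ∀ {i T} → i < K → Seed i v T → Inv i (entryAt S nbs v i T ∷ S i)
    step-inv i< seed = Step.inv′ (invs i<) seed nbs-adj (no-closed i<)

    seedAt-seed : ∀ {i T} → i ≤ K → seedAt S nbs v i ≡ just T → Seed i v T
    seedAt-seed {zero}  _ refl = base v<n
    seedAt-seed {suc i} i< eq with seedAt S nbs v i in eqᵢ
    ... | just T with d ≤? length (links (entryAt S nbs v i T))
    seedAt-seed {suc i} i< refl | just T | yes d≤ =
      promote (step-inv i< (seedAt-seed (<⇒≤ i<) eqᵢ)) (here refl) d≤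

    -- A seed at level `K` would consist of at least `d ^ K > n` distinct numbers below `n`.
    seedAt-K : seedAt S nbs v K ≡ nothing
    seedAt-K with seedAt S nbs v K in eq
    ... | nothing = refl
    ... | just T  = ⊥-elim (<⇒≱ n<d^K (≤-trans (Seed.large s) T≤n))
      where
      s : Seed K v T
      s = seedAt-seed ≤-refl eq
      T≤n : length T ≤ n
      T≤n = subst (length T ≤_) (length-upTo n)
        (unique-⊆⇒length-≤ (Seed.unique s) λ w∈ → ∈-upTo⁺ (Seed.bounded s w∈))

    extend-inv : AllInv (extend S nbs v)
    extend-inv {i} i< with seedAt S nbs v i in eq
    ... | just T  = step-inv i< (seedAt-seed (<⇒≤ i<) eq)
    ... | nothing = invs i<

    -- Equal codes mean equal level, number of links and slot. The edge makes the cluster of `f` a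
    -- link of the newcomer's cluster, and then `separate` forbids the equalities.
    neighbour-code≢ : ∀ {i j T f} → i < K → Seed i v T → length (links (entryAt S nbs v i T)) < d →
      j < K → f ∈ S j → vertex f ∈ nbs → length (links f) < d →
      code i (entryAt S nbs v i T) ≢ code j f
    neighbour-code≢ {i} {j} {T} {f} i< seed few j< f∈ nb few′ eq
      with code-injective i j (entryAt S nbs v i T) f few few′
             (≤-<-trans (Inv.slot≤ (step-inv i< seed) (here refl)) few)
             (≤-<-trans (Inv.slot≤ (invs j<) f∈) few′) eq
    ... | refl , lengths , slots = Inv.separate (step-inv i< seed) (there f∈) (here refl)
      (Level.links-received (S i) nbs f∈ (inj₂ nb)) (sym lengths) (sym slots)

    record Final (c : Maybe ℕ) : Set where
      field
        {level}  : ℕ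
        {seed}   : Cluster
        level<K  : level < K
        reached  : seedAt S nbs v level ≡ just seed
        few      : length (links (entryAt S nbs v level seed)) < d
        is-code  : c ≡ just (code level (entryAt S nbs v level seed))

    -- Descending from a level not reached, the first one reached is where promotion failed, for
    -- want of `d` links. Level 0 is always reached.
    final-below : ∀ k → k ≤ K → seedAt S nbs v k ≡ nothing → Final (codeBelow S nbs v k)
    final-below (suc k) k< stop with seedAt S nbs v k in eq
    ... | nothing = final-below k (<⇒≤ k<) eq
    ... | just T with d ≤? length (links (entryAt S nbs v k T))
    final-below (suc k) k< () | just T | yes _
    final-below (suc k) k< stop | just T | no ¬d≤ = record
      { level<K = k< ; reached = eq ; few = ≰⇒> ¬d≤ ; is-code = refl }

    final : Final (codeBelow S nbs v K)
    final = final-below K ≤-refl seedAt-K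

    newest-coded : ∀ {xs} → (∀ {c} → c ∈ xs → ∃ λ u → u ∈ nbs × Coded S u c) →
      Coded (extend S nbs v) v (pick (codeBelow S nbs v K) xs)
    newest-coded {xs} nbs-coded = go final
      where
      go : ∀ {c} → Final c → Coded (extend S nbs v) v (pick c xs)
      go record { level = i ; seed = T ; level<K = i<
                ; reached = reached ; few = few ; is-code = refl } = record
        { level<K = i<
        ; present = here-extend {S} reached
        ; owner   = refl
        ; few     = few
        ; is-code = pick-just free
        }
        where
        free : code i (entryAt S nbs v i T) ∉ xs
        free c∈ with nbs-coded c∈
        ... | u , u∈ , record { level<K = j< ; present = f∈ ; owner = refl ; few = few′ ; is-code = eq } =
          neighbour-code≢ i< (seedAt-seed (<⇒≤ i<) reached) few j< f∈ u∈ few′ eq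

  newest-nbs : ∀ {m} {G : Graph m} {N} → Embeds (G ▷ N) → ∀ {u} → u ∈ ranks N → E m u
  newest-nbs {N = N} emb u∈ with ∈-map⁻ rank u∈
  ... | u , u∈N , refl = emb zero (suc u) (∈-members⁻ u∈N)

  history-inv : ∀ {m} (G : Graph m) → m ≤ n → Embeds G → AllInv (history G)
  history-inv ∅       _   _   _  = inv-[]
  history-inv (G ▷ N) m≤n emb i< =
    Newest.extend-inv (history-inv G (<⇒≤ m≤n) (older emb)) m≤n (newest-nbs {G = G} emb) i<

  coded : ∀ {m} (G : Graph m) → m ≤ n → Embeds G → ∀ u → Coded (history G) (rank u) (lookup (colours G) u)
  coded (G ▷ N) m≤n emb (suc u) = record
    { level<K = level<K ; present = there-extend {S = history G} present
    ; owner = owner ; few = few ; is-code = is-code }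
    where open Coded (coded G (<⇒≤ m≤n) (older emb) u)
  coded (G ▷ N) m≤n emb zero =
    Newest.newest-coded (history-inv G (<⇒≤ m≤n) (older emb)) m≤n (newest-nbs {G = G} emb) nbs-coded
    where
    nbs-coded : ∀ {c} → c ∈ coloursOf (colours G) N → ∃ λ u → u ∈ ranks N × Coded (history G) u c
    nbs-coded c∈ with ∈-map⁻ (lookup (colours G)) c∈
    ... | u , u∈ , refl = rank u , ∈-map⁺ rank u∈ , coded G (<⇒≤ m≤n) (older emb) u

  colour-< : ∀ {m} (G : Graph m) → m ≤ n → Embeds G → ∀ u → lookup (colours G) u < K * d * d
  colour-< G m≤n emb u = subst (_< K * d * d) (sym is-code)
    (digits-< (digits-< level<K few) (≤-<-trans (Inv.slot≤ (history-inv G m≤n emb level<K) present) few))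
    where open Coded (coded G m≤n emb u)
-- Odd girth

module _ {n} (G : Graph n) where

  Edge : ℕ → ℕ → Set
  Edge x y = ∃₂ λ u v → rank u ≡ x × rank v ≡ y × Adj G u v

  edge-sym : ∀ {x y} → Edge x y → Edge y x
  edge-sym (u , v , p , q , a) = v , u , q , p , adj-sym G a

  lift-walk : ∀ {k x y} u → rank u ≡ x → Walk Edge k x y → ∃ λ v → rank v ≡ y × Walk (Adj G) k u v
  lift-walk u eq [] = u , eq , []
  lift-walk u eq ((u′ , v , p , q , a) ∷ w) with rank-injective u u′ (trans eq (sym p)) | lift-walk v q w
  ... | refl | z , r , w′ = z , r , a ∷ w′

  odd-closed-edge-walk⇒odd-cycle : ∀ {k x} → Odd k → Walk Edge k x x → ∃ λ l → OddCycle G l × l ≤ k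
  -- Odd length forces a first step, which supplies a graph vertex of rank `x`.
  odd-closed-edge-walk⇒odd-cycle odd w@((u , _ , p , _) ∷ _) with lift-walk u p w
  ... | v , q , w′ with rank-injective u v (trans p (sym q))
  ...   | refl = odd-closed-walk⇒odd-cycle G odd w′

oddGirth≤ : ∀ {n} {G : Graph n} {γ g l} → IsOddGirth G γ → [ g ] ≤⁺ γ → OddCycle G l → g ≤ l
oddGirth≤ {γ = [ k ]} (_ , least) g≤k cyc = ≤-trans ([≤]-injective g≤k) (least _ cyc)
oddGirth≤ {γ = ⊤⁺}     none        _   cyc = ⊥-elim (none _ cyc)

linkLength-odd : ∀ i → Odd (linkLength i)
linkLength-odd i = double (radius i)
  where
  double : ∀ r → Odd (r + suc r)
  double zero    = refl
  double (suc r) rewrite +-suc r (suc r) = double r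

linkLength-mono : ∀ {i j} → i ≤ j → linkLength i ≤ linkLength j
linkLength-mono i≤j = +-mono-≤ (radius-mono (≤⇒≤′ i≤j)) (s≤s (radius-mono (≤⇒≤′ i≤j)))
  where
  radius-mono : ∀ {i j} → i ≤′ j → radius i ≤ radius j
  radius-mono ≤′-refl = ≤-refl
  radius-mono (≤′-step {j} p) = ≤-trans (radius-mono p)
    (≤-trans (m≤m+n (radius j) (linkLength j)) (m≤m+n (seedRadius (suc j)) _))

coloursUsed-≤ : ∀ {n d K} .{{_ : NonZero d}} (G : Graph n) {γ} → n < d ^ K → IsOddGirth G γ →
  [ 2 + linkLength K ] ≤⁺ γ → coloursUsed (Algorithm.algorithm d K) G ≤ K * d * d
coloursUsed-≤ {n} {d} {K} G n< girth g≤ =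
  subst (λ c → length (deduplicate _≟_ (Vec.toList c)) ≤ K * d * d)
    (sym (Algorithm.colouring≡colours d K G))
    (deduplicate-bounded (K * d * d) _ bounded)
  where
  no-closed : ∀ {i x} → i < K → ¬ Walk (Edge G) (linkLength i) x x
  no-closed {i} i< w with odd-closed-edge-walk⇒odd-cycle G (linkLength-odd i) w
  ... | l , cyc , l≤ = <⇒≱
    (≤-<-trans (≤-trans l≤ (linkLength-mono (<⇒≤ i<))) (m<n+m (linkLength K) {2} z<s))
    (oddGirth≤ girth g≤ cyc)
  bounded : ∀ {c} → c ∈ Vec.toList (Algorithm.colours d K G) → c < K * d * d
  bounded {c} c∈ = subst (_< K * d * d) (sym (lookup-index p))
    (Correctness.colour-< (Edge G) (edge-sym G) n d K n< no-closed G ≤-refl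
      (λ u v a → u , v , refl , refl , a) (index p))
    where
    p = ∈-toList⁻ c∈

-- The bound in terms of ε

-- When `n` grows by one, the integer part of the root stays or grows by one. It is at least 1,
-- hence written `suc s`.
integer-root : ∀ k .{{_ : NonZero k}} n → 1 ≤ n → ∃ λ s → suc s ^ k ≤ n × n < suc (suc s) ^ k
integer-root k (suc zero)    _ = 0 , ≤-reflexive (^-zeroˡ k) , ^-monoʳ-< 2 ≤-refl (>-nonZero⁻¹ k)
integer-root k (suc (suc n)) _ with integer-root k (suc n) z<s
... | s , lo , hi with suc (suc n) <? suc (suc s) ^ k
...   | yes lt = s , m≤n⇒m≤1+n lo , lt
...   | no ¬lt = suc s , ≮⇒≥ ¬lt , ≤-<-trans hi (^-monoˡ-< k (n<1+n (suc (suc s))))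

lower<upper : ∀ x {q r} → ℝ.Lower x q → ℝ.Upper x r → q ℚ.< r
lower<upper x {q} {r} lo up with ℚ.<-cmp q r
... | tri< q<r _ _  = q<r
... | tri≈ _ refl _ = ⊥-elim (ℝ.disjoint x q (lo , up))
... | tri> _ _ r<q  =
  ⊥-elim (ℝ.disjoint x r (Equivalence.from (ℝ.lower-rounded x r) (q , r<q , lo) , up))

-- Roundedness gives a rational `(a + 1) / (b + 1)` strictly between 0 and `x`, so every `p / q`
-- above `x` exceeds `1 / (b + 1)`.
positive⇒reciprocal : ∀ x → Positive x → ∃ λ b → ∀ p q .{{_ : NonZero q}} →
  ℝ.Upper x ((+ p) ℚ./ q) → q ≤ p * suc b
positive⇒reciprocal x pos with Equivalence.to (ℝ.lower-rounded x ℚ.0ℚ) pos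
... | r@(ℚ.mkℚ (+ suc a) b _) , _ , lo = b , bound
  where
  bound : ∀ p q .{{_ : NonZero q}} → ℝ.Upper x ((+ p) ℚ./ q) → q ≤ p * suc b
  bound p (suc q) up
    with ℚᵘ.<-respʳ-≃ (ℚ.toℚᵘ-fromℚᵘ (ℚᵘ.mkℚᵘ (+ p) q)) (ℚ.toℚᵘ-mono-< (lower<upper x lo up))
  ... | ℚᵘ.*<* lt = ≤-trans (m≤m+n (suc q) (a * suc q))
    (<⇒≤ (ℤ.drop‿+<+ (subst₂ ℤ._<_ (sym (ℤ.pos-* (suc a) (suc q))) (sym (ℤ.pos-* p (suc b))) lt)))
... | ℚ.mkℚ (+ zero) b _   , ℚ.*<* (ℤ.+<+ ()) , _
... | ℚ.mkℚ ℤ.-[1+ _ ] b _ , ℚ.*<* () , _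

-- With `t = suc s`, replacing `d = t + 1` by `2 * t` costs a factor 4. There remains `t ^ (2 * q)`,
-- and `2 * q ≤ 2 * b * p` compares it with `(t ^ (2 * b)) ^ p ≤ n ^ p`.
power-bound : ∀ {n p q b s} → suc s ^ (2 * b) ≤ n → q ≤ p * b →
  (2 * b * (2 + s) * (2 + s)) ^ q ≤ (4 * (2 * b)) ^ q * n ^ p
power-bound {n} {p} {q} {b} {s} root q≤ = begin
  (K * d * d) ^ q                 ≤⟨ ^-monoˡ-≤ q (*-mono-≤ (*-monoʳ-≤ K d≤) d≤) ⟩
  (K * (2 * t) * (2 * t)) ^ q     ≡⟨ cong (_^ q) square ⟩
  (4 * K * t ^ 2) ^ q             ≡⟨ ^-distrib-* (4 * K) (t ^ 2) q ⟩
  (4 * K) ^ q * (t ^ 2) ^ q       ≡⟨ cong ((4 * K) ^ q *_) (^-*-assoc t 2 q) ⟩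
  (4 * K) ^ q * t ^ (2 * q)       ≤⟨ *-monoʳ-≤ ((4 * K) ^ q) (^-monoʳ-≤ t exponents) ⟩
  (4 * K) ^ q * t ^ (K * p)       ≡⟨ cong ((4 * K) ^ q *_) (^-*-assoc t K p) ⟨
  (4 * K) ^ q * (t ^ K) ^ p       ≤⟨ *-monoʳ-≤ ((4 * K) ^ q) (^-monoˡ-≤ p root) ⟩
  (4 * K) ^ q * n ^ p             ∎
  where
  open ≤-Reasoning
  open +-*-Solver
  K = 2 * b
  t = suc s
  d = suc t
  d≤ : d ≤ 2 * t
  d≤ = s≤s (≤-trans (≤-reflexive (sym (+-identityʳ t))) (m≤n+m (t + 0) s))
  square : K * (2 * t) * (2 * t) ≡ 4 * K * t ^ 2
  square = solve 2 (λ K t → K :* (con 2 :* t) :* (con 2 :* t) := con 4 :* K :* (t :^ 2)) refl K t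
  exponents : 2 * q ≤ K * p
  exponents = ≤-trans (*-monoʳ-≤ 2 q≤)
    (≤-reflexive (trans (cong (2 *_) (*-comm p b)) (sym (*-assoc 2 b p))))
  ^-distrib-* : ∀ x y k → (x * y) ^ k ≡ x ^ k * y ^ k
  ^-distrib-* x y zero    = refl
  ^-distrib-* x y (suc k) = trans (cong (x * y *_) (^-distrib-* x y k))
    (solve 4 (λ x y a b → x :* y :* (a :* b) := x :* a :* (y :* b)) refl x y (x ^ k) (y ^ k))

theorem1 : (ε : ℝ) → Positive ε →
    ∃ λ (g′ : ℕ) → ∃ λ (C : ℕ) →
    3 ≤ g′ × Odd g′ ×
    (∀ (n : ℕ) → 1 ≤ n →
    ∃ λ (A : OnlineAlgorithm) →
    ∀ (G : Graph n) (γ : ℕ ⁺) → IsOddGirth G γ → [ g′ ] ≤⁺ γ →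
    coloursUsed A G ≤ C · n ^ᴿ ε)
theorem1 ε pos with positive⇒reciprocal ε pos
-- Adding 2 keeps the number odd, makes it at least 3 and puts it strictly above every
-- `linkLength i` with `i < K`.
... | b , q≤ = 2 + linkLength K
             , 4 * K
             , s≤s (s≤s (≤-trans (s≤s z≤n) (m≤n+m (suc (radius K)) (radius K))))
             , linkLength-odd K , colour
  where
  K : ℕ
  K = 2 * suc b
  colour : ∀ n → 1 ≤ n → ∃ λ A → ∀ (G : Graph n) γ → IsOddGirth G γ → [ 2 + linkLength K ] ≤⁺ γ →
    coloursUsed A G ≤ 4 * K · n ^ᴿ ε
  colour n 1≤n with integer-root K n 1≤n
  -- `2 + s` is the least `d` with `n < d ^ K`, and within a factor 2 of the integer root `suc s`.
  ... | s , lo , hi = Algorithm.algorithm (2 + s) K , λ G γ girth g≤ p q up →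
    ≤-trans (^-monoˡ-≤ q (coloursUsed-≤ G hi girth g≤)) (power-bound {p = p} {q} lo (q≤ p q up))
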